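{- Let $S_3^n=S_{K_3}^n$. Then $\chi_i'(S_3^1)=3$, $\chi_i'(S_3^2)=4$, and $\chi_i'(S_3^n)=5$ for every $n\ge 3$.
   Context: For a graph $H$ with at least one edge, an injective edge $k$-coloring is a map $c:E(H)\to\{1,\dots,k\}$ such that whenever $e_1=xy$, $e_2=yz$, $e_3=zu$ are edges of $H$ with $x,y,z$ distinct and $u\notin\{y,z\}$ (the case $u=x$ being allowed), we have $c(e_1)\ne c(e_3)$. The injective chromatic index $\chi_i'(H)$ is the least $k$ for which such a coloring exists. For a graph $G$ and positive integer $n$, the generalized Sierpiński graph $S_G^n$ has vertex set $V(G)^n$, and $(u_1,\dots,u_n)$, $(v_1,\dots,v_n)$ are adjacent if and only if there is $d\in\{1,\dots,n\}$ with $u_i=v_i$ for $i<d$, $u_dv_d\in E(G)$, and $u_i=v_d$, $v_i=u_d$ for all $i>d$. $K_3$ is the triangle. -}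

module Defs where

open import Level using (0ℓ)
open import Data.Nat.Base using (ℕ; _≤_)
open import Data.Fin.Base using (Fin; _<_)
open import Data.Vec.Base using (Vec; lookup)
open import Data.Product.Base using (Σ-syntax; _×_; _,_; swap)
open import Function.Base using (_∘_)
open import Relation.Binary.Core using (Rel)
open import Relation.Binary.Definitions using (Symmetric; Irreflexive)
open import Relation.Binary.PropositionalEquality using (_≡_; _≢_; sym; cong)

record Graph : Set₁ where
  field
    V        : Set
    _~_      : Rel V 0ℓ
    ~-sym    : Symmetric _~_
    ~-irrefl : Irreflexive _≡_ _~_

K : ℕ → Graph
K n = record
  { V        = Fin n
  ; _~_      = _≢_
  ; ~-sym    = λ u≢v → u≢v ∘ sym
  ; ~-irrefl = λ u≡v u≢v → u≢v u≡v
  }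

module _ (G : Graph) where
  open Graph G

  SierpińskiAdj : (n : ℕ) → Rel (Vec V n) 0ℓ
  SierpińskiAdj n u v = Σ[ d ∈ Fin n ]
      (∀ i → i < d → lookup u i ≡ lookup v i)
    × (lookup u d ~ lookup v d)
    × (∀ i → d < i → lookup u i ≡ lookup v d × lookup v i ≡ lookup u d)

  Sierpiński : ℕ → Graph
  Sierpiński n = record
    { V        = Vec V n
    ; _~_      = SierpińskiAdj n
    ; ~-sym    = λ (d , before , at , after) →
                   d , (λ i → sym ∘ before i) , ~-sym at , (λ i → swap ∘ after i)
    ; ~-irrefl = λ u≡v (d , _ , at , _) → ~-irrefl (cong (λ w → lookup w d) u≡v) at
    }

module _ (H : Graph) where
  open Graph H

  -- Edges are undirected and proofs of adjacency need not be unique.  A map on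
  -- E(H) is a map on directed edges satisfying unoriented; applying that law
  -- twice also gives independence of the adjacency proof.
  record InjectiveEdgeColouring (k : ℕ) : Set where
    field
      colour     : ∀ {u v} → u ~ v → Fin k
      unoriented : ∀ {u v} (p : u ~ v) (q : v ~ u) → colour p ≡ colour q
      injective  : ∀ {x y z u} (e₁ : x ~ y) (e₂ : y ~ z) (e₃ : z ~ u) →
                   x ≢ y → y ≢ z → x ≢ z → u ≢ y → u ≢ z →
                   colour e₁ ≢ colour e₃

  -- χᵢ′(H) = k, as a relation.  An edgeless H is not excluded; its index is 0.
  InjectiveChromaticIndex : ℕ → Set
  InjectiveChromaticIndex k =
    InjectiveEdgeColouring k × (∀ j → InjectiveEdgeColouring j → k ≤ j)

{-# OPTIONS --safe #-}
-- S₃ⁿ⁺¹ is three copies of S₃ⁿ joined by three links between extreme vertices.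
-- Two edges conflict only if they are links at the same smallest triangle, a
-- link and the side opposite to it, two sides of one triangle, or sides of two
-- linked triangles that touch the link.  So a colouring of a copy is seen from
-- outside only through its three corner triangles and the colours it allows on
-- the links leaving them.  With five colours there are two colourings of S₃²,
-- differing at corner 2 only, such that each extends, up to what is seen from
-- outside, to S₃³ by joining copies of the two; hence to all S₃ⁿ.  With one
-- colour fewer than claimed, backtracking over the edges of S₃¹, S₃² and S₃³
-- fails, and S₃³ embeds in S₃ⁿ for n ≥ 3 by prefixing words with zeros.
module Submission where

open import Defs
open import Data.Bool.Base using (Bool; false; _∧_; _∨_; T)
open import Data.Bool.ListAction using (all)
open import Data.Bool.Properties using (T-∧; T-∨)
open import Data.Fin.Base using (Fin; zero; suc; inject≤)
open import Data.Fin.Patterns using (0F; 1F; 2F; 3F; 4F)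
open import Data.Fin.Properties using (_≟_; _<?_; all?; any?; inject≤-injective)
open import Data.List.Base using (List; []; _∷_; [_]; _++_; map; mapMaybe; allFin; cartesianProductWith)
open import Data.List.Membership.Propositional.Properties using (∈-allFin)
import Data.List.Relation.Unary.All as All
import Data.List.Relation.Unary.All.Properties as All
import Data.Maybe.Base as Maybe
open import Data.Nat.Base using (ℕ; zero; suc; _≤_; z≤n; s≤s)
open import Data.Nat.Properties using (≰⇒>)
open import Data.Product.Base using (_×_; _,_; proj₁; proj₂; ∃-syntax)
open import Data.Sum.Base using (_⊎_; inj₁; inj₂)
open import Data.Vec.Base using (Vec; []; _∷_; lookup)
import Data.Vec.Properties as Vec
open import Function.Base using (_∘_)
open import Function.Bundles using (Equivalence)
open import Relation.Binary.Definitions using (Decidable)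
open import Relation.Binary.PropositionalEquality
  using (_≡_; _≢_; refl; sym; trans; cong; cong₂; subst₂; ≢-sym)
open import Relation.Nullary.Decidable
  using (Dec; yes; no; isYes; dec⇒maybe; ¬?; _×-dec_; _⊎-dec_; _→-dec_; toWitness; from-yes)
open import Relation.Nullary.Negation using (¬_; contradiction)

private variable
  k n : ℕ

S₃ : ℕ → Graph
S₃ = Sierpiński (K 3)

-- Adjacency in S₃ⁿ by recursion on the common prefix

Constant : Fin 3 → Vec (Fin 3) n → Set
Constant j u = ∀ a → lookup u a ≡ j

data Edge : Vec (Fin 3) n → Vec (Fin 3) n → Set where
  link : ∀ {i j} {u v : Vec (Fin 3) n} → i ≢ j → Constant j u → Constant i v → Edge (i ∷ u) (j ∷ v)
  copy : ∀ {i} {u v : Vec (Fin 3) n} → Edge u v → Edge (i ∷ u) (i ∷ v)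

adjacent⇒edge : (u v : Vec (Fin 3) n) → Graph._~_ (S₃ n) u v → Edge u v
adjacent⇒edge (i ∷ u) (j ∷ v) (zero , _ , i≢j , after) =
  link i≢j (λ a → proj₁ (after (suc a) (s≤s z≤n))) (λ a → proj₂ (after (suc a) (s≤s z≤n)))
adjacent⇒edge (i ∷ u) (j ∷ v) (suc d , before , at , after) with refl ← before zero (s≤s z≤n) =
  copy (adjacent⇒edge u v (d , (λ a → before (suc a) ∘ s≤s) , at , (λ a → after (suc a) ∘ s≤s)))

edge-sym : {u v : Vec (Fin 3) n} → Edge u v → Edge v u
edge-sym (link i≢j u≡j v≡i) = link (≢-sym i≢j) v≡i u≡j
edge-sym (copy e)           = copy (edge-sym e)

constant-unique : ∀ {j} (u v : Vec (Fin 3) n) → Constant j u → Constant j v → u ≡ v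
constant-unique []      []      _   _   = refl
constant-unique (_ ∷ u) (_ ∷ v) u≡j v≡j =
  cong₂ _∷_ (trans (u≡j zero) (sym (v≡j zero))) (constant-unique u v (u≡j ∘ suc) (v≡j ∘ suc))

corner-has-no-link : ∀ {i j l} {u : Vec (Fin 3) (suc n)} → i ≢ j → Constant j u → ¬ Constant l (i ∷ u)
corner-has-no-link i≢j u≡j iu≡l = i≢j (trans (iu≡l zero) (trans (sym (iu≡l (suc zero))) (u≡j zero)))

-- The tail of a link's end names the neighbouring copy and thereby fixes the other end, so no
-- vertex lies on two links.
link-end-unique : ∀ {a b i} (y : Vec (Fin 3) (suc n)) {x z : Vec (Fin 3) (suc n)} →
                  Constant a y → Constant b y → Constant i x → Constant i z → a ∷ x ≡ b ∷ z
link-end-unique y y≡a y≡b x≡i z≡i = cong₂ _∷_ (trans (sym (y≡a zero)) (y≡b zero)) (constant-unique _ _ x≡i z≡i)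

-- Colourings assembled from coloured triangles

-- sides i is the colour of the side opposite to corner i, and pendants i is
-- the colour of an edge leaving the triangle at corner i.
record Triangle (k : ℕ) : Set where
  constructor ⟨_,_⟩
  field sides pendants : Vec (Fin k) 3

  side pendant : Fin 3 → Fin k
  side    = lookup sides
  pendant = lookup pendants

open Triangle using (side; pendant)

-- A Piece of height n colours S₃ⁿ⁺¹ together with one further edge leaving
-- each of the three extreme vertices.
data Piece (k : ℕ) : ℕ → Set where
  triangle : Triangle k → Piece k 0
  join     : (Fin 3 → Piece k n) → Piece k (suc n)

corner : Fin 3 → Piece k n → Triangle k
corner _ (triangle t) = t
corner j (join p)     = corner j (p j)

third : Fin 3 → Fin 3 → Fin 3
third 0F 1F = 2F
third 0F _  = 1F
third 1F 0F = 2F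
third 1F _  = 0F
third 2F 0F = 1F
third 2F _  = 0F

third-≢ : ∀ i j → i ≢ j → third i j ≢ i
third-≢ = from-yes (all? λ i → all? λ j → ¬? (i ≟ j) →-dec ¬? (third i j ≟ i))

third-comm : ∀ i j → i ≢ j → third i j ≡ third j i
third-comm = from-yes (all? λ i → all? λ j → ¬? (i ≟ j) →-dec (third i j ≟ third j i))

third-unique : ∀ i j l → i ≢ j → j ≢ l → i ≢ l → third i j ≡ l
third-unique = from-yes (all? λ i → all? λ j → all? λ l →
  ¬? (i ≟ j) →-dec (¬? (j ≟ l) →-dec (¬? (i ≟ l) →-dec (third i j ≟ l))))

Distinct : (Fin 3 → Fin k) → Set
Distinct f = ∀ i j → i ≢ j → f i ≢ f j

-- Any two sides lie on the triangle, any two pendants have a side between them, and a pendant is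
-- one side away from the side opposite its corner. A pendant may share a colour with the sides it
-- touches.
Proper : Triangle k → Set
Proper t = Distinct (side t) × Distinct (pendant t) × (∀ i → pendant t i ≢ side t i)

-- Both pendants stand for the same link. A side touches corner `i` exactly when it is opposite to
-- another corner, hence `a ≢ i`.
Compatible : Fin 3 → Fin 3 → Triangle k → Triangle k → Set
Compatible i j s t =
  pendant s i ≡ pendant t j × (∀ a b → a ≢ i → b ≢ j → side s a ≢ side t b)

Valid : Piece k n → Set
Valid (triangle t) = Proper t
Valid (join p)     = (∀ i → Valid (p i)) × (∀ i j → i ≢ j → Compatible j i (corner j (p i)) (corner i (p j)))

distinct? : (f : Fin 3 → Fin k) → Dec (Distinct f)
distinct? f = all? λ i → all? λ j → ¬? (i ≟ j) →-dec ¬? (f i ≟ f j)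

compatible? : ∀ i j (s t : Triangle k) → Dec (Compatible i j s t)
compatible? i j s t = (pendant s i ≟ pendant t j) ×-dec
  (all? λ a → all? λ b → ¬? (a ≟ i) →-dec (¬? (b ≟ j) →-dec ¬? (side s a ≟ side t b)))

valid? : (p : Piece k n) → Dec (Valid p)
valid? (triangle t) =
  distinct? (side t) ×-dec distinct? (pendant t) ×-dec all? λ i → ¬? (pendant t i ≟ side t i)
valid? (join p) = (all? λ i → valid? (p i)) ×-dec
  (all? λ i → all? λ j → ¬? (i ≟ j) →-dec compatible? j i (corner j (p i)) (corner i (p j)))

-- Injectivity of the assembled colouring

private variable
  u v x y z : Vec (Fin 3) n

pieceColour : Piece k n → {u v : Vec (Fin 3) (suc n)} → Edge u v → Fin k
pieceColour (triangle t) (link {i = i} {j} _ _ _) = side t (third i j)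
pieceColour (triangle t) (copy ())
pieceColour (join p)     (link {i = i} {j} _ _ _) = pendant (corner j (p i)) j
pieceColour (join p)     (copy {i = i} e)         = pieceColour (p i) e

colour-unoriented : (p : Piece k n) → Valid p → (e : Edge u v) (e′ : Edge v u) → pieceColour p e ≡ pieceColour p e′
colour-unoriented (triangle t) _ (link {i = i} {j} i≢j _ _) (link _ _ _) = cong (side t) (third-comm i j i≢j)
colour-unoriented (triangle t) _ (copy ()) _
colour-unoriented (triangle t) _ _ (copy ())
colour-unoriented (join p) (_ , compatible) (link i≢j _ _) (link _ _ _) = proj₁ (compatible _ _ i≢j)
colour-unoriented (join p) _ (link i≢i _ _) (copy _) = contradiction refl i≢i
colour-unoriented (join p) _ (copy _) (link i≢i _ _) = contradiction refl i≢i
colour-unoriented (join p) (valid , _) (copy {i = i} e) (copy e′) = colour-unoriented (p i) (valid i) e e′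

corner-edge : ∀ {j} (p : Piece k n) (e : Edge u v) → Constant j u →
              ∃[ a ] a ≢ j × pieceColour p e ≡ side (corner j p) a
corner-edge (triangle t) (link {i = i} {l} i≢l _ _) u≡j with refl ← u≡j zero =
  third i l , third-≢ i l i≢l , refl
corner-edge (triangle t) (copy ()) _
corner-edge (join p) (link i≢l u≡l _) iu≡j = contradiction iu≡j (corner-has-no-link i≢l u≡l)
corner-edge (join p) (copy {i = i} e) iu≡j with refl ← iu≡j zero = corner-edge (p i) e (iu≡j ∘ suc)

pendants-differ : ∀ {i j} {u v : Vec (Fin 3) (suc n)} (p : Piece k n) → Valid p →
                  Edge u v → Constant i u → Constant j v →
                  pendant (corner i p) i ≢ pendant (corner j p) j
pendants-differ (triangle t) (_ , distinct , _) (link i≢j _ _) u≡i v≡j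
  with refl ← u≡i zero | refl ← v≡j zero = distinct _ _ i≢j
pendants-differ (triangle t) _ (copy ()) _ _
pendants-differ (join p) _ (link i≢l u≡l _) iu≡i _ = contradiction iu≡i (corner-has-no-link i≢l u≡l)
pendants-differ (join p) (valid , _) (copy {i = i} e) u≡i v≡j
  with refl ← u≡i zero | refl ← v≡j zero =
  -- Both ends are the same extreme vertex here, so the recursive call makes a pendant colour differ
  -- from itself.
  contradiction refl (pendants-differ (p i) (valid i) e (u≡i ∘ suc) (v≡j ∘ suc))

pendant-avoids : ∀ {j} (p : Piece k n) → Valid p → (e : Edge x y) (f : Edge y z) → Constant j x → z ≢ x →
                 pendant (corner j p) j ≢ pieceColour p f
pendant-avoids (triangle t) (_ , _ , avoids) (link {u = []} {[]} i≢j _ _) (link {v = []} j≢l _ _) x≡j z≢x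
  with refl ← x≡j zero
  rewrite third-unique _ _ _ j≢l (λ l≡i → z≢x (cong (_∷ []) l≡i)) (≢-sym i≢j) = avoids _
pendant-avoids (triangle t) _ (copy ()) _ _ _
pendant-avoids (triangle t) _ _ (copy ()) _ _
pendant-avoids (join p) _ (link i≢l u≡l _) _ iu≡j _ = contradiction iu≡j (corner-has-no-link i≢l u≡l)
pendant-avoids (join p) (valid , _) (copy {i = i} e) (link _ y≡l _) x≡j _ with refl ← x≡j zero =
  pendants-differ (p i) (valid i) e (x≡j ∘ suc) y≡l
pendant-avoids (join p) (valid , _) (copy {i = i} e) (copy f) x≡j z≢x with refl ← x≡j zero =
  pendant-avoids (p i) (valid i) e f (x≡j ∘ suc) (z≢x ∘ cong (i ∷_))

-- In a join, sort by which edges are links. Two consecutive links cannot occur, a middle link is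
-- covered by `Compatible`, and an outer link acts as a pendant of the copy containing the middle
-- edge.
colour-injective : (p : Piece k n) → Valid p → (e₁ : Edge x y) (e₂ : Edge y z) (e₃ : Edge z u) →
                   x ≢ z → u ≢ y → pieceColour p e₁ ≢ pieceColour p e₃
colour-injective (triangle t) (distinct , _)
  (link {u = []} {[]} i≢j _ _) (link {v = []} j≢l _ _) (link {i = l} {m} {v = []} l≢m _ _) x≢z _
  rewrite third-unique _ _ _ i≢j j≢l (x≢z ∘ cong (_∷ [])) = distinct _ _ (≢-sym (third-≢ l m l≢m))
colour-injective (triangle t) _ (copy ()) _ _ _ _
colour-injective (triangle t) _ _ (copy ()) _ _ _
colour-injective (triangle t) _ _ _ (copy ()) _ _
colour-injective (join p) _ (link {v = y} _ x≡j y≡i) (link _ y≡l z≡j) _ x≢z _ =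
  contradiction (link-end-unique y y≡i y≡l x≡j z≡j) x≢z
colour-injective (join p) _ (copy _) (link {v = z} _ y≡l z≡j) (link _ z≡m u≡l) _ u≢y =
  contradiction (link-end-unique z z≡m z≡j u≡l y≡l) u≢y
colour-injective (join p) (valid , compatible) (copy {i = i} e₁) (link {j = j} i≢j y≡j z≡i) (copy e₃) _ _ eq
  with _ , a≢j , eq₁ ← corner-edge (p i) (edge-sym e₁) y≡j | _ , b≢i , eq₃ ← corner-edge (p j) e₃ z≡i =
  proj₂ (compatible i j i≢j) _ _ a≢j b≢i
    (trans (sym eq₁) (trans (colour-unoriented (p i) (valid i) (edge-sym e₁) e₁) (trans eq eq₃)))
colour-injective (join p) (valid , compatible) (link {j = j} i≢j _ y≡i) (copy e₂) (copy e₃) _ u≢y eq =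
  pendant-avoids (p j) (valid j) e₂ e₃ y≡i (u≢y ∘ cong (j ∷_)) (trans (sym (proj₁ (compatible _ _ i≢j))) eq)
colour-injective (join p) (valid , compatible) (link {j = j} i≢j _ y≡i) (copy e₂) (link _ z≡l _) _ _ eq =
  pendants-differ (p j) (valid j) e₂ y≡i z≡l (trans (sym (proj₁ (compatible _ _ i≢j))) eq)
colour-injective (join p) (valid , _) (copy {i = i} e₁) (copy e₂) (link _ z≡l _) x≢z _ eq =
  pendant-avoids (p i) (valid i) (edge-sym e₂) (edge-sym e₁) z≡l (x≢z ∘ cong (i ∷_))
    (trans (sym eq) (colour-unoriented (p i) (valid i) e₁ (edge-sym e₁)))
colour-injective (join p) (valid , _) (copy {i = i} e₁) (copy e₂) (copy e₃) x≢z u≢y =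
  colour-injective (p i) (valid i) e₁ e₂ e₃ (x≢z ∘ cong (i ∷_)) (u≢y ∘ cong (i ∷_))

toColouring : (p : Piece k n) → Valid p → InjectiveEdgeColouring (S₃ (suc n)) k
toColouring p valid = record
  { colour     = λ {u} {v} e → pieceColour p (adjacent⇒edge u v e)
  ; unoriented = λ {u} {v} e f → colour-unoriented p valid (adjacent⇒edge u v e) (adjacent⇒edge v u f)
  ; injective  = λ {x} {y} {z} {u} e₁ e₂ e₃ _ _ x≢z u≢y _ →
      colour-injective p valid (adjacent⇒edge x y e₁) (adjacent⇒edge y z e₂) (adjacent⇒edge z u e₃) x≢z u≢y
  }

-- Explicit colourings for the upper bounds

S₃¹-3-colourable : InjectiveEdgeColouring (S₃ 1) 3
S₃¹-3-colourable = toColouring p (from-yes (valid? p))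
  where
  p : Piece 3 0
  p = triangle ⟨ 0F ∷ 1F ∷ 2F ∷ [] , 1F ∷ 2F ∷ 0F ∷ [] ⟩

S₃²-4-colourable : InjectiveEdgeColouring (S₃ 2) 4
S₃²-4-colourable = toColouring p (from-yes (valid? p))
  where
  p : Piece 4 1
  p = join (triangle ∘ lookup
    ( ⟨ 0F ∷ 1F ∷ 2F ∷ [] , 1F ∷ 0F ∷ 3F ∷ [] ⟩
    ∷ ⟨ 2F ∷ 1F ∷ 3F ∷ [] , 0F ∷ 2F ∷ 1F ∷ [] ⟩
    ∷ ⟨ 0F ∷ 2F ∷ 3F ∷ [] , 3F ∷ 1F ∷ 0F ∷ [] ⟩
    ∷ []))

-- part b i says which twin of height n is copy i of twin b of height n + 1.
part : Fin 2 → Fin 3 → Fin 2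
part b = lookup (0F ∷ 1F ∷ b ∷ [])

-- All outgoing edges get colour 4. The sides touching corner 0 have colours 1 and 3, those touching
-- corner 1 have 0 and 4, and those touching corner 2 have 0 and 4 if `b` is 0, but 2 and 3 if `b`
-- is 1. Corner 2 of copy 0 faces a corner 0 and so needs the first twin; corner 2 of copy 1 faces a
-- corner 1 and needs the second.
twin : Fin 2 → ∀ n → Piece 5 (suc n)
twin b zero = join (triangle ∘ lookup
  ( ⟨ 2F ∷ 1F ∷ 3F ∷ [] , 4F ∷ 3F ∷ 1F ∷ [] ⟩
  ∷ ⟨ 4F ∷ 1F ∷ 0F ∷ [] , 3F ∷ 4F ∷ 2F ∷ [] ⟩
  ∷ lookup ( ⟨ 0F ∷ 4F ∷ 3F ∷ [] , 1F ∷ 2F ∷ 4F ∷ [] ⟩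
           ∷ ⟨ 2F ∷ 3F ∷ 0F ∷ [] , 1F ∷ 2F ∷ 4F ∷ [] ⟩
           ∷ []) b
  ∷ []))
twin b (suc n) = join λ i → twin (part b i) n

-- Corner `j` comes from copy `j`; only corner 2 depends on `b`, and copy 2 is again the twin `b`.
corner-twin : ∀ j b n → corner j (twin b n) ≡ corner j (twin b 0)
corner-twin j  b zero    = refl
corner-twin 0F b (suc n) = corner-twin 0F 0F n
corner-twin 1F b (suc n) = corner-twin 1F 1F n
corner-twin 2F b (suc n) = corner-twin 2F b n

-- As corners do not change with `n`, one finite check on pieces of height 1 covers every later
-- join.
valid-twin : ∀ b n → Valid (twin b n)
valid-twin b zero    = from-yes (all? λ c → valid? (twin c 0)) b
valid-twin b (suc n) = (λ i → valid-twin _ n) , λ i j i≢j →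
  subst₂ (Compatible j i) (sym (corner-twin j _ n)) (sym (corner-twin i _ n)) (compatible b i j i≢j)
  where
  compatible : ∀ c i j → i ≢ j →
               Compatible j i (corner j (twin (part c i) 0)) (corner i (twin (part c j) 0))
  compatible = from-yes (all? λ c → all? λ i → all? λ j → ¬? (i ≟ j) →-dec
    compatible? j i (corner j (twin (part c i) 0)) (corner i (twin (part c j) 0)))

-- Lower bounds

weaken : ∀ {H j} → j ≤ k → InjectiveEdgeColouring H j → InjectiveEdgeColouring H k
weaken j≤k c = record
  { colour     = λ e → inject≤ (colour e) j≤k
  ; unoriented = λ e f → cong (λ a → inject≤ a j≤k) (unoriented e f)
  ; injective  = λ e₁ e₂ e₃ x≢y y≢z x≢z u≢y u≢z →
      injective e₁ e₂ e₃ x≢y y≢z x≢z u≢y u≢z ∘ inject≤-injective j≤k j≤k _ _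
  }
  where open InjectiveEdgeColouring c

not-colourable⇒lower-bound : ∀ {H} → ¬ InjectiveEdgeColouring H k → ∀ j → InjectiveEdgeColouring H j → suc k ≤ j
not-colourable⇒lower-bound none j c = ≰⇒> λ j≤k → none (weaken j≤k c)

restrict : InjectiveEdgeColouring (S₃ (suc n)) k → InjectiveEdgeColouring (S₃ n) k
restrict {n} c = record
  { colour     = λ e → colour (prefix e)
  ; unoriented = λ e f → unoriented (prefix e) (prefix f)
  ; injective  = λ e₁ e₂ e₃ x≢y y≢z x≢z u≢y u≢z →
      injective (prefix e₁) (prefix e₂) (prefix e₃)
        (x≢y ∘ Vec.∷-injectiveʳ) (y≢z ∘ Vec.∷-injectiveʳ) (x≢z ∘ Vec.∷-injectiveʳ)
        (u≢y ∘ Vec.∷-injectiveʳ) (u≢z ∘ Vec.∷-injectiveʳ)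
  }
  where
  open InjectiveEdgeColouring c

  prefix : ∀ {u v} → Graph._~_ (S₃ n) u v → Graph._~_ (S₃ (suc n)) (0F ∷ u) (0F ∷ v)
  prefix (d , before , at , after) =
    suc d , (λ { zero _ → refl ; (suc a) (s≤s a<d) → before a a<d }) , at ,
    (λ { (suc a) (s≤s d<a) → after a d<a })

-- Backtracking search for edge colourings

module Backtracking (H : Graph) (_≟ⱽ_ : Decidable (_≡_ {A = Graph.V H})) (_~?_ : Decidable (Graph._~_ H)) where
  open Graph H

  record E : Set where
    constructor edge
    field
      {end₁ end₂} : V
      adjacent    : end₁ ~ end₂

  open E

  reverse : E → E
  reverse e = edge (~-sym (adjacent e))

  -- Vertices enter from the end of the list, each bringing its edges to those already present; on
  -- `words` the search thus finishes one copy before the next.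
  edges : List V → List E
  edges []       = []
  edges (v ∷ vs) = edges vs ++ mapMaybe (λ u → Maybe.map edge (dec⇒maybe (v ~? u))) vs

  Joined Conflict : E → E → Set
  Joined e f   = (end₂ e ~ end₁ f) × end₁ e ≢ end₁ f × end₂ f ≢ end₂ e
  Conflict e f = (Joined e f ⊎ Joined e (reverse f)) ⊎ (Joined (reverse e) f ⊎ Joined (reverse e) (reverse f))

  joined? : Decidable Joined
  joined? e f = (end₂ e ~? end₁ f) ×-dec ¬? (end₁ e ≟ⱽ end₁ f) ×-dec ¬? (end₂ f ≟ⱽ end₂ e)

  conflict? : Decidable Conflict
  conflict? e f = (joined? e f ⊎-dec joined? e (reverse f))
            ⊎-dec (joined? (reverse e) f ⊎-dec joined? (reverse e) (reverse f))

  -- The rows of the conflict matrix are tabulated once, so that the search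
  -- does not decide conflicts again at each of its nodes.
  conflicts : List E → List E → List (List Bool)
  conflicts done []       = []
  conflicts done (e ∷ es) = map (λ f → isYes (conflict? e f)) done ∷ conflicts (e ∷ done) es

  clash : Fin k → List Bool → List (Fin k) → Bool
  clash c (b ∷ bs) (d ∷ ds) = (b ∧ isYes (c ≟ d)) ∨ clash c bs ds
  clash c _        _        = false

  -- A Bool rather than a Dec: evaluating a Dec would retain the whole search tree.
  refuted : List (List Bool) → List (Fin k) → Bool
  refuted     []           _  = false
  refuted {k} (row ∷ rows) ds = all (λ c → clash c row ds ∨ refuted rows (c ∷ ds)) (allFin k)

  module _ (colouring : InjectiveEdgeColouring H k) where
    open InjectiveEdgeColouring colouring

    colourᴱ : E → Fin k
    colourᴱ e = colour (adjacent e)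

    joined⇒≢ : ∀ e f → Joined e f → colourᴱ e ≢ colourᴱ f
    joined⇒≢ e f (m , x≢z , u≢y) = injective (adjacent e) m (adjacent f)
      (λ eq → ~-irrefl eq (adjacent e)) (λ eq → ~-irrefl eq m) x≢z u≢y
      (λ eq → ~-irrefl (sym eq) (adjacent f))

    reverse-colour : ∀ e → colourᴱ e ≡ colourᴱ (reverse e)
    reverse-colour e = unoriented _ _

    conflict⇒≢ : ∀ e f → Conflict e f → colourᴱ e ≢ colourᴱ f
    conflict⇒≢ e f (inj₁ (inj₁ p)) eq = joined⇒≢ e f p eq
    conflict⇒≢ e f (inj₁ (inj₂ p)) eq = joined⇒≢ e (reverse f) p (trans eq (reverse-colour f))
    conflict⇒≢ e f (inj₂ (inj₁ p)) eq = joined⇒≢ (reverse e) f p (trans (sym (reverse-colour e)) eq)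
    conflict⇒≢ e f (inj₂ (inj₂ p)) eq =
      joined⇒≢ (reverse e) (reverse f) p (trans (sym (reverse-colour e)) (trans eq (reverse-colour f)))

    no-clash : ∀ e done → ¬ T (clash (colourᴱ e) (map (λ f → isYes (conflict? e f)) done) (map colourᴱ done))
    no-clash e (f ∷ done) t with Equivalence.to T-∨ t
    ... | inj₂ t′ = no-clash e done t′
    ... | inj₁ t′ with b , eq ← Equivalence.to T-∧ t′ =
      conflict⇒≢ e f (toWitness {a? = conflict? e f} b) (toWitness {a? = colourᴱ e ≟ colourᴱ f} eq)

    -- Follow the branch that gives each edge its colour in `colouring`: it never clashes, so it
    -- runs out of rows, where `refuted` is `false`.
    not-refuted : ∀ done es → ¬ T (refuted (conflicts done es) (map colourᴱ done))
    not-refuted done (e ∷ es) t with Equivalence.to T-∨ (All.lookup (All.all⁺ _ _ t) (∈-allFin (colourᴱ e)))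
    ... | inj₁ t′ = no-clash e done t′
    ... | inj₂ t′ = not-refuted (e ∷ done) es t′

words : ∀ n → List (Vec (Fin 3) n)
words zero    = [ [] ]
words (suc n) = cartesianProductWith _∷_ (allFin 3) (words n)

adjacent? : ∀ n → Decidable (Graph._~_ (S₃ n))
adjacent? n u v = any? λ d →
        (all? λ i → (i <? d) →-dec (lookup u i ≟ lookup v i))
  ×-dec ¬? (lookup u d ≟ lookup v d)
  ×-dec (all? λ i → (d <? i) →-dec ((lookup u i ≟ lookup v d) ×-dec (lookup v i ≟ lookup u d)))

module S₃-Backtracking n = Backtracking (S₃ n) (Vec.≡-dec _≟_) (adjacent? n)

search : ℕ → ℕ → Bool
search n k = refuted {k = k} (conflicts [] (edges (words n))) []
  where open S₃-Backtracking n

-- The implicit argument reduces to the unit type once the search evaluates to true, so type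
-- checking runs the search.
not-colourable : ∀ n k → {T (search n k)} → ¬ InjectiveEdgeColouring (S₃ n) k
not-colourable n k {t} c = not-refuted c [] (edges (words n)) t
  where open S₃-Backtracking n

S₃³⁺ᵐ-not-4-colourable : ∀ m → ¬ InjectiveEdgeColouring (S₃ (suc (suc (suc m)))) 4
S₃³⁺ᵐ-not-4-colourable zero    = not-colourable 3 4
S₃³⁺ᵐ-not-4-colourable (suc m) = S₃³⁺ᵐ-not-4-colourable m ∘ restrict

mainTheorem5 : InjectiveChromaticIndex (Sierpiński (K 3) 1) 3
    × InjectiveChromaticIndex (Sierpiński (K 3) 2) 4
    × ((n : ℕ) → 3 ≤ n → InjectiveChromaticIndex (Sierpiński (K 3) n) 5)
mainTheorem5 =
    (S₃¹-3-colourable , not-colourable⇒lower-bound (not-colourable 1 2))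
  , (S₃²-4-colourable , not-colourable⇒lower-bound (not-colourable 2 3))
  , λ where
      (suc (suc (suc m))) (s≤s (s≤s (s≤s z≤n))) →
          -- `twin b n` has height n + 1 and therefore colours S₃ⁿ⁺².
          toColouring (twin 0F (suc m)) (valid-twin 0F (suc m))
        , not-colourable⇒lower-bound (S₃³⁺ᵐ-not-4-colourable m)
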